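{- Let $\mathcal{L}$ be a signature containing at least one constant symbol. Let $\mathcal{V}$ be a coherent variety of $\mathcal{L}$-algebras with a term-definable meet-semilattice reduct (with associated order $\le$), and let $t(x)$ be a unary $\mathcal{L}$-term satisfying $$\mathcal{V}\models t(x)\le x\quad\text{and}\quad\mathcal{V}\models x\le y\Rightarrow t(x)\le t(y).$$ Suppose also that $\mathcal{V}$ satisfies the following fixpoint embedding condition with respect to $t(x)$: for any finitely generated $\mathbf{A}\in\mathcal{V}$ and $a\in A$, there exists an algebra $\mathbf{B}\in\mathcal{V}$ such that $\mathbf{A}$ is a subalgebra of $\mathbf{B}$ and the meet $\bigwedge_{k\in\mathbb{N}}t^k(a)$ exists in $\mathbf{B}$ and satisfies $$\bigwedge_{k\in\mathbb{N}}t^k(a)=t\Bigl(\bigwedge_{k\in\mathbb{N}}t^k(a)\Bigr).$$ Then there exists $n\in\mathbb{N}$ such that $t$ is $n$-potent in $\mathcal{V}$, i.e. $\mathcal{V}\models t^{n+1}(x)\approx t^n(x)$.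
   Context: For a unary term $t$: $t^0(x)=x$ and $t^{k+1}(x)=t(t^k(x))$ for $k\in\mathbb{N}$ (with $0\in\mathbb{N}$). A term-definable meet-semilattice reduct means a binary term $\wedge$ that is a semilattice operation on every member of $\mathcal{V}$; $x\le y$ means $x\wedge y\approx x$. $\mathcal{V}$ is coherent if every finitely generated subalgebra of a finitely presented member of $\mathcal{V}$ is finitely presented, where finitely presented means isomorphic to $\mathbf{F}(\overline{x})/\Theta$ with $\mathbf{F}(\overline{x})$ the free algebra of $\mathcal{V}$ over a finite set $\overline{x}$ and $\Theta$ a finitely generated congruence. -}

module Defs where

open import Level using (Level) renaming (suc to lsuc)
open import Algebra.Core using (Op₂)
open import Algebra.Lattice.Structures using (IsMeetSemilattice)
open import Data.Fin.Base using (Fin; zero)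
open import Data.List.Base using (List)
open import Data.List.Membership.Propositional using (_∈_)
open import Data.Nat.Base using (ℕ; zero; suc)
open import Data.Product.Base using (Σ-syntax; ∃; ∃-syntax; _×_; _,_; proj₁; proj₂)
open import Data.Vec.Functional using (Vector; []; _∷_)
open import Function.Definitions using (Injective; Surjective)
open import Relation.Binary.Bundles using (Setoid)
open import Relation.Binary.Core using (Rel; _⇒_)
open import Relation.Binary.PropositionalEquality.Core using (_≡_)
open import Relation.Binary.Structures using (IsEquivalence)
open import Relation.Unary using (Pred)

private
  variable
    ℓ : Level
    X Y : Set

-- Everything (operation symbols, carriers, equalities, sets of equations)
-- lives in one arbitrary universe ℓ, so that the algebras presented by
-- generators and relations are among the algebras quantified over.

record Signature ℓ : Set (lsuc ℓ) where
  field
    Op    : Set ℓ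
    arity : Op → ℕ

open Signature public

HasConstant : Signature ℓ → Set ℓ
HasConstant L = Σ[ c ∈ Op L ] arity L c ≡ 0

------------------------------------------------------------------------
-- Terms

data Term (L : Signature ℓ) (X : Set) : Set ℓ where
  var : X → Term L X
  op  : (f : Op L) → Vector (Term L X) (arity L f) → Term L X

infix 8 _[_]

_[_] : {L : Signature ℓ} → Term L X → (X → Term L Y) → Term L Y
var x   [ σ ] = σ x
op f ts [ σ ] = op f (λ i → ts i [ σ ])

iterate : {L : Signature ℓ} → Term L (Fin 1) → ℕ → Term L (Fin 1)
iterate t zero    = var zero
iterate t (suc k) = t [ (λ _ → iterate t k) ]

------------------------------------------------------------------------
-- Algebras, with setoid equality

record Algebra (L : Signature ℓ) : Set (lsuc ℓ) where
  field
    setoid : Setoid ℓ ℓ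
  open Setoid setoid public
  field
    ⟦_⟧    : (f : Op L) → Vector Carrier (arity L f) → Carrier
    ⟦⟧-cong : ∀ f {as bs} → (∀ i → as i ≈ bs i) → ⟦ f ⟧ as ≈ ⟦ f ⟧ bs

  eval : (X → Carrier) → Term L X → Carrier
  eval ρ (var x)   = ρ x
  eval ρ (op f ts) = ⟦ f ⟧ (λ i → eval ρ (ts i))

  eval₁ : Term L (Fin 1) → Carrier → Carrier
  eval₁ t a = eval (a ∷ []) t

  eval₂ : Term L (Fin 2) → Op₂ Carrier
  eval₂ s a b = eval (a ∷ b ∷ []) s

open Algebra public using (Carrier)

_⊨_≈_ : {L : Signature ℓ} → Algebra L → Term L X → Term L X → Set ℓ
_⊨_≈_ {X = X} A s t = ∀ (ρ : X → Carrier A) → eval ρ s ≈ eval ρ t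
  where open Algebra A using (_≈_; eval)

module _ {L : Signature ℓ} where

  record Hom (A B : Algebra L) : Set ℓ where
    private
      module A = Algebra A
      module B = Algebra B
    field
      map  : A.Carrier → B.Carrier
      cong : ∀ {x y} → x A.≈ y → map x B.≈ map y
      homo : ∀ f as → map (A.⟦ f ⟧ as) B.≈ B.⟦ f ⟧ (λ i → map (as i))

  -- An embedding of A into B presents A as a subalgebra of B.
  record Embedding (A B : Algebra L) : Set ℓ where
    field
      hom       : Hom A B
      injective : Injective (Algebra._≈_ A) (Algebra._≈_ B) (Hom.map hom)
    open Hom hom public

  record _≅_ (A B : Algebra L) : Set ℓ where
    field
      embedding  : Embedding A B
      surjective : Surjective (Algebra._≈_ A) (Algebra._≈_ B)
                     (Embedding.map embedding)
    open Embedding embedding public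

  ----------------------------------------------------------------------
  -- Generated subalgebras

  module _ (A : Algebra L) where
    open Algebra A using (_≈_; refl; sym; trans; ⟦_⟧; ⟦⟧-cong)

    data Sg (G : Pred (Carrier A) ℓ) : Pred (Carrier A) ℓ where
      gen  : ∀ {a} → G a → Sg G a
      op   : ∀ f {as} → (∀ i → Sg G (as i)) → Sg G (⟦ f ⟧ as)
      resp : ∀ {a b} → a ≈ b → Sg G a → Sg G b

    generatedSubalgebra : Pred (Carrier A) ℓ → Algebra L
    generatedSubalgebra G = record
      { setoid = record
          { Carrier       = ∃ (Sg G)
          ; _≈_           = λ x y → proj₁ x ≈ proj₁ y
          ; isEquivalence = record { refl = refl ; sym = sym ; trans = trans }
          }
      ; ⟦_⟧     = λ f as → ⟦ f ⟧ (λ i → proj₁ (as i)) , op f (λ i → proj₂ (as i))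
      ; ⟦⟧-cong = λ f eqs → ⟦⟧-cong f eqs
      }

    FinitelyGenerated : Set ℓ
    FinitelyGenerated = ∃[ gs ] ∀ a → Sg (_∈ gs) a

  ----------------------------------------------------------------------
  -- Congruences and quotients

  -- Congruences contain the setoid equality of the algebra, which plays the
  -- role of the identity relation.
  record Congruence (A : Algebra L) : Set (lsuc ℓ) where
    open Algebra A using (_≈_; ⟦_⟧)
    field
      _∼_           : Rel (Carrier A) ℓ
      isEquivalence : IsEquivalence _∼_
      reflexive     : _≈_ ⇒ _∼_
      compatible    : ∀ f {as bs} → (∀ i → as i ∼ bs i) → ⟦ f ⟧ as ∼ ⟦ f ⟧ bs

  _/_ : (A : Algebra L) → Congruence A → Algebra L
  A / Θ = record
    { setoid  = record { isEquivalence = Congruence.isEquivalence Θ }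
    ; ⟦_⟧     = Algebra.⟦_⟧ A
    ; ⟦⟧-cong = Congruence.compatible Θ
    }

  module _ (A : Algebra L) where
    open Algebra A using (_≈_; ⟦_⟧)

    data CgRel (R : Rel (Carrier A) ℓ) : Rel (Carrier A) ℓ where
      gen        : ∀ {a b} → R a b → CgRel R a b
      reflexive  : ∀ {a b} → a ≈ b → CgRel R a b
      sym        : ∀ {a b} → CgRel R a b → CgRel R b a
      trans      : ∀ {a b c} → CgRel R a b → CgRel R b c → CgRel R a c
      compatible : ∀ f {as bs} → (∀ i → CgRel R (as i) (bs i)) →
                   CgRel R (⟦ f ⟧ as) (⟦ f ⟧ bs)

    Cg : Rel (Carrier A) ℓ → Congruence A
    Cg R = record
      { _∼_           = CgRel R
      ; isEquivalence = record
          { refl = reflexive (Algebra.refl A) ; sym = sym ; trans = trans }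
      ; reflexive     = reflexive
      ; compatible    = compatible
      }

------------------------------------------------------------------------
-- Varieties

-- A variety is given by a set of equations in countably many variables;
-- its members are the algebras satisfying them.
record Variety (L : Signature ℓ) : Set (lsuc ℓ) where
  field
    Equations : Rel (Term L ℕ) ℓ

module _ {L : Signature ℓ} where

  infix 4 _∈ᵥ_

  _∈ᵥ_ : Algebra L → Variety L → Set ℓ
  A ∈ᵥ V = ∀ {s t} → Variety.Equations V s t → A ⊨ s ≈ t

  _⊨ᵥ_≈_ : Variety L → Term L X → Term L X → Set (lsuc ℓ)
  V ⊨ᵥ s ≈ t = ∀ A → A ∈ᵥ V → A ⊨ s ≈ t

  module _ (V : Variety L) where
    open Variety V

    -- Derivability from the equations of V in equational logic.
    data _⊢_≈_ (X : Set) : Rel (Term L X) ℓ where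
      axiom : ∀ {s t} → Equations s t → (σ : ℕ → Term L X) →
              _⊢_≈_ X (s [ σ ]) (t [ σ ])
      refl  : ∀ {s} → _⊢_≈_ X s s
      sym   : ∀ {s t} → _⊢_≈_ X s t → _⊢_≈_ X t s
      trans : ∀ {s t u} → _⊢_≈_ X s t → _⊢_≈_ X t u → _⊢_≈_ X s u
      cong  : ∀ f {ss ts} → (∀ i → _⊢_≈_ X (ss i) (ts i)) →
              _⊢_≈_ X (op f ss) (op f ts)

    Free : Set → Algebra L
    Free X = record
      { setoid  = record
          { Carrier       = Term L X
          ; _≈_           = _⊢_≈_ X
          ; isEquivalence = record { refl = refl ; sym = sym ; trans = trans }
          }
      ; ⟦_⟧     = op
      ; ⟦⟧-cong = cong
      }

    -- Free X belongs to V and is free there over X: every assignment of X in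
    -- a member of V extends to a homomorphism, uniquely.

    private
      eval-Free : (σ : Y → Term L X) (s : Term L Y) →
                  _⊢_≈_ X (Algebra.eval (Free X) σ s) (s [ σ ])
      eval-Free σ (var x)   = refl
      eval-Free σ (op f ss) = cong f (λ i → eval-Free σ (ss i))

    Free∈V : Free X ∈ᵥ V
    Free∈V {s = s} {t = t} e σ =
      trans (eval-Free σ s) (trans (axiom e σ) (sym (eval-Free σ t)))

    module _ {A : Algebra L} (A∈V : A ∈ᵥ V) (ρ : X → Carrier A) where
      private module A = Algebra A

      eval-[] : (σ : Y → Term L X) (s : Term L Y) →
                A.eval ρ (s [ σ ]) A.≈ A.eval (λ y → A.eval ρ (σ y)) s
      eval-[] σ (var x)   = A.refl
      eval-[] σ (op f ss) = A.⟦⟧-cong f (λ i → eval-[] σ (ss i))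

      soundness : ∀ {s t} → _⊢_≈_ X s t → A.eval ρ s A.≈ A.eval ρ t
      soundness (axiom {s} {t} e σ) =
        A.trans (eval-[] σ s) (A.trans (A∈V e _) (A.sym (eval-[] σ t)))
      soundness refl        = A.refl
      soundness (sym p)     = A.sym (soundness p)
      soundness (trans p q) = A.trans (soundness p) (soundness q)
      soundness (cong f ps) = A.⟦⟧-cong f (λ i → soundness (ps i))

      extension : Hom (Free X) A
      extension = record
        { map = A.eval ρ ; cong = soundness ; homo = λ _ _ → A.refl }

      extension-unique : (h : Hom (Free X) A) →
                         (∀ x → Hom.map h (var x) A.≈ ρ x) →
                         ∀ s → Hom.map h s A.≈ A.eval ρ s
      extension-unique h h≈ρ (var x)   = h≈ρ x
      extension-unique h h≈ρ (op f ss) =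
        A.trans (Hom.homo h f ss)
                (A.⟦⟧-cong f (λ i → extension-unique h h≈ρ (ss i)))

    FinitelyPresented : Algebra L → Set ℓ
    FinitelyPresented A =
      Σ[ n ∈ ℕ ] Σ[ ps ∈ List (Term L (Fin n) × Term L (Fin n)) ]
        A ≅ (Free (Fin n) / Cg (Free (Fin n)) (λ s t → (s , t) ∈ ps))

    Coherent : Set (lsuc ℓ)
    Coherent = ∀ A → A ∈ᵥ V → FinitelyPresented A →
               ∀ (gs : List (Carrier A)) →
               FinitelyPresented (generatedSubalgebra A (_∈ gs))

    IsMeetSemilatticeTerm : Term L (Fin 2) → Set (lsuc ℓ)
    IsMeetSemilatticeTerm m = ∀ A → A ∈ᵥ V →
      IsMeetSemilattice (Algebra._≈_ A) (Algebra.eval₂ A m)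

-- The order of the reduct given by the binary term m: x ≤ y iff x ∧ y ≈ x.
module Order {L : Signature ℓ} (m : Term L (Fin 2)) (A : Algebra L) where
  open Algebra A using (_≈_; eval₁; eval₂)

  infix 4 _≤_

  _≤_ : Rel (Carrier A) _
  x ≤ y = eval₂ m x y ≈ x

  IsMeet : (ℕ → Carrier A) → Carrier A → Set _
  IsMeet s b = (∀ k → b ≤ s k) × (∀ c → (∀ k → c ≤ s k) → c ≤ b)

  IsFixpointMeet : Term L (Fin 1) → Carrier A → Carrier A → Set _
  IsFixpointMeet t a b =
    IsMeet (λ k → eval₁ (iterate t k) a) b × b ≈ eval₁ t b

module _ {L : Signature ℓ} (V : Variety L) (m : Term L (Fin 2))
         (t : Term L (Fin 1)) where
  open Algebra using (eval₁)
  open Order m using (IsFixpointMeet) renaming (_≤_ to Le)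

  Decreasing : Set (lsuc ℓ)
  Decreasing = ∀ A → A ∈ᵥ V → ∀ x → Le A (eval₁ A t x) x

  Monotone : Set (lsuc ℓ)
  Monotone = ∀ A → A ∈ᵥ V →
    ∀ x y → Le A x y → Le A (eval₁ A t x) (eval₁ A t y)

  FixpointEmbedding : Set (lsuc ℓ)
  FixpointEmbedding =
    ∀ A → A ∈ᵥ V → FinitelyGenerated A → ∀ (a : Carrier A) →
    Σ[ B ∈ Algebra L ] B ∈ᵥ V × Σ[ ι ∈ Embedding A B ]
      ∃[ b ] IsFixpointMeet B t (Embedding.map ι a) b

module _ {L : Signature ℓ} (V : Variety L) where

  Potent : Term L (Fin 1) → ℕ → Set (lsuc ℓ)
  Potent t n = V ⊨ᵥ iterate t (suc n) ≈ iterate t n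

{-# OPTIONS --safe #-}

-- Let A be presented by x, y, z subject to z ≤ x ≤ y and t(x) ≈ x, and let D
-- be presented by y, z subject to z ≤ tᵏ(y) for all k.  In A one has
-- z ≤ tᵏ(x) ≤ tᵏ(y); conversely, in an extension of D where ⋀ₖ tᵏ(y) is a
-- fixpoint of t, that meet satisfies the relations on x.  So the subalgebra of
-- A generated by y, z satisfies no more equations in y, z than D.  By coherence
-- these equations have a finite basis, which by compactness follows from
-- z ≤ tᵏ(y) for k ≤ n, for some n.  Hence these finitely many inequalities
-- imply z ≤ tⁿ⁺¹(y), and z := tⁿ(y) gives tⁿ(y) ≤ tⁿ⁺¹(y).

module Submission where

open import Defs
open import Algebra.Lattice.Structures using (IsMeetSemilattice)
open import Data.Fin.Base using (Fin; zero; suc)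
open import Data.List.Base as List using (List; []; _∷_; _++_; length; lookup)
open import Data.List.Membership.Propositional using (_∈_)
open import Data.List.Membership.Propositional.Properties using (∈-lookup; ∈-tabulate⁺)
open import Data.List.Relation.Unary.All as All using (All; []; _∷_)
open import Data.List.Relation.Unary.All.Properties
  using (++⁺; ++⁻; map⁺; map⁻; tabulate⁺; tabulate⁻)
open import Data.List.Relation.Unary.Any as Any using (here; there)
open import Data.List.Relation.Unary.Any.Properties using (lookup-index)
open import Data.Nat.Base using (ℕ; zero; suc; _≤_; _⊔_; _≤′_; ≤′-refl; ≤′-step)
open import Data.Nat.Properties using (≤-refl; ≤-trans; m≤m⊔n; m≤n⊔m; ≤⇒≤′)
open import Data.Product.Base using (∃-syntax; _×_; _,_; proj₁; proj₂)
import Data.Vec.Functional as Vector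
open import Function.Base using (_∘_; id)
open import Level using (Level)
import Relation.Binary.Construct.NaturalOrder.Left as NaturalOrder
open import Relation.Binary.PropositionalEquality as ≡ using (_≡_; refl)

private
  variable
    ℓ p q : Level
    L : Signature ℓ
    X Y : Set

-- Common bounds for finite families

UpClosed : (ℕ → Set p) → Set p
UpClosed P = ∀ {i j} → i ≤ j → P i → P j

-- Upward closure lets the maximum of the individual bounds serve every entry.
uniform : {A : Set q} {P : A → ℕ → Set p} → (∀ {x} → UpClosed (P x)) →
          ∀ {xs} → All (λ x → ∃[ n ] P x n) xs → ∃[ n ] All (λ x → P x n) xs
uniform up []             = 0 , []
uniform up ((m , p) ∷ ps) with n , qs ← uniform up ps =
  m ⊔ n , up (m≤m⊔n m n) p ∷ All.map (up (m≤n⊔m m n)) qs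

uniform-Fin : ∀ {k} {P : Fin k → ℕ → Set p} → (∀ {i} → UpClosed (P i)) →
              (∀ i → ∃[ n ] P i n) → ∃[ n ] ∀ i → P i n
uniform-Fin up ps with n , qs ← uniform up (tabulate⁺ {f = id} ps) =
  n , tabulate⁻ qs

-- Equations under homomorphisms, quotients and embeddings

Equation : Signature ℓ → Set → Set ℓ
Equation L X = Term L X × Term L X

Satisfies : (A : Algebra L) → (X → Carrier A) → Equation L X → Set _
Satisfies A ρ (s , t) = eval ρ s ≈ eval ρ t
  where open Algebra A using (eval; _≈_)

module _ (A : Algebra L) where
  private module A = Algebra A

  eval-cong : {ρ σ : X → A.Carrier} → (∀ x → ρ x A.≈ σ x) →
              ∀ s → A.eval ρ s A.≈ A.eval σ s
  eval-cong ρ≈σ (var x)   = ρ≈σ x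
  eval-cong ρ≈σ (op f ss) = A.⟦⟧-cong f (λ i → eval-cong ρ≈σ (ss i))

  Satisfies-cong : {ρ σ : X → A.Carrier} → (∀ x → ρ x A.≈ σ x) →
                   ∀ e → Satisfies A ρ e → Satisfies A σ e
  Satisfies-cong ρ≈σ (s , t) eq =
    A.trans (A.sym (eval-cong ρ≈σ s)) (A.trans eq (eval-cong ρ≈σ t))

  id-≅ : A ≅ A
  id-≅ = record
    { embedding = record
        { hom = record { map = id ; cong = id ; homo = λ _ _ → A.refl }
        ; injective = id
        }
    ; surjective = λ y → y , id
    }

  quotient-hom : (Θ : Congruence A) → Hom A (A / Θ)
  quotient-hom Θ = record
    { map  = id
    ; cong = Congruence.reflexive Θ
    ; homo = λ _ _ → Congruence.reflexive Θ A.refl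
    }

module _ {A B : Algebra L} (h : Hom A B) where
  private module B = Algebra B
  private module h = Hom h

  map-eval : (ρ : X → Carrier A) → ∀ s →
             h.map (Algebra.eval A ρ s) B.≈ B.eval (h.map ∘ ρ) s
  map-eval ρ (var x)   = B.refl
  map-eval ρ (op f ss) =
    B.trans (h.homo f _) (B.⟦⟧-cong f (λ i → map-eval ρ (ss i)))

  preserves : (ρ : X → Carrier A) → ∀ e →
              Satisfies A ρ e → Satisfies B (h.map ∘ ρ) e
  preserves ρ (s , t) eq =
    B.trans (B.sym (map-eval ρ s)) (B.trans (h.cong eq) (map-eval ρ t))

-- The quotient map is the identity on carriers, so an assignment into the quotient is already one
-- into `A`.
quotient∈V : (V : Variety L) (A : Algebra L) → A ∈ᵥ V →
             (Θ : Congruence A) → (A / Θ) ∈ᵥ V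
quotient∈V V A A∈V Θ {s} {t} e ρ = preserves (quotient-hom A Θ) ρ (s , t) (A∈V e ρ)

module _ {A B : Algebra L} (ι : Embedding A B) where
  private module B = Algebra B
  open Embedding ι using (hom; injective)

  reflects : (ρ : X → Carrier A) → ∀ e →
             Satisfies B (Embedding.map ι ∘ ρ) e → Satisfies A ρ e
  reflects ρ (s , t) eq = injective
    (B.trans (map-eval hom ρ s) (B.trans eq (B.sym (map-eval hom ρ t))))

-- Finitely generated subalgebras

module _ (A : Algebra L) where
  private module A = Algebra A

  inclusion : ∀ G → Embedding (generatedSubalgebra A G) A
  inclusion G = record
    { hom = record { map = proj₁ ; cong = id ; homo = λ _ _ → A.refl }
    ; injective = id
    }

  module _ (gs : List (Carrier A)) where

    generators : Fin (length gs) → Carrier (generatedSubalgebra A (_∈ gs))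
    generators i = lookup gs i , gen (∈-lookup i)

    Sg⇒term : ∀ {a} → Sg A (_∈ gs) a → ∃[ u ] A.eval (lookup gs) u A.≈ a
    Sg⇒term (gen a∈gs)  = var (Any.index a∈gs) , A.reflexive (≡.sym (lookup-index a∈gs))
    Sg⇒term (op f as)   =
      op f (λ i → proj₁ (Sg⇒term (as i))) , A.⟦⟧-cong f (λ i → proj₂ (Sg⇒term (as i)))
    Sg⇒term (resp eq a) with u , u≈a ← Sg⇒term a = u , A.trans u≈a eq

    generators-generate :
      let module S = Algebra (generatedSubalgebra A (_∈ gs)) in
      ∀ s → ∃[ u ] S.eval generators u S.≈ s
    generators-generate (a , a∈) with u , u≈a ← Sg⇒term a∈ =
      u , A.trans (map-eval (Embedding.hom (inclusion (_∈ gs))) generators u) u≈a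

-- Algebras presented by generators and relations

module _ (V : Variety L) where

  Presented : (X : Set) → (Term L X → Term L X → Set _) → Algebra L
  Presented X R = Free V X / Cg (Free V X) R

  Presented∈V : ∀ {R} → Presented X R ∈ᵥ V
  Presented∈V {X = X} {s = s} {t} =
    quotient∈V V (Free V X) (λ {s} {t} → Free∈V V {s = s} {t}) (Cg _ _) {s} {t}

  eval-var : ∀ {R} (s : Term L X) →
             let module P = Algebra (Presented X R) in P.eval var s P.≈ s
  eval-var (var x)   = reflexive refl
  eval-var (op f ss) = compatible f (λ i → eval-var (ss i))

  module _ (A : Algebra L) (A∈V : A ∈ᵥ V) (ρ : X → Carrier A) where
    private module A = Algebra A

    Presented-elim : ∀ {R} → (∀ {s t} → R s t → Satisfies A ρ (s , t)) →
                     ∀ {s t} → CgRel (Free V X) R s t → Satisfies A ρ (s , t)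
    Presented-elim R⇒ (gen r)           = R⇒ r
    Presented-elim R⇒ (reflexive eq)    = soundness V {A = A} A∈V ρ eq
    Presented-elim R⇒ (sym eq)          = A.sym (Presented-elim R⇒ eq)
    Presented-elim R⇒ (trans eq eq′)    =
      A.trans (Presented-elim R⇒ eq) (Presented-elim R⇒ eq′)
    Presented-elim R⇒ (compatible f eq) = A.⟦⟧-cong f (λ i → Presented-elim R⇒ (eq i))

    Presented-hom : ∀ {R} → (∀ {s t} → R s t → Satisfies A ρ (s , t)) →
                    Hom (Presented X R) A
    Presented-hom R⇒ = record
      { map = A.eval ρ ; cong = Presented-elim R⇒ ; homo = λ _ _ → A.refl }

  Presented-finitelyGenerated : ∀ {n R} → FinitelyGenerated (Presented (Fin n) R)
  Presented-finitelyGenerated {n} {R} = gs , all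
    where
    gs = List.tabulate var
    all : ∀ s → Sg (Presented (Fin n) R) (_∈ gs) s
    all (var i)   = gen (∈-tabulate⁺ i)
    all (op f ss) = op f (λ i → all (ss i))

  -- Compactness and finite bases of equations

  Entails : (ℕ → Equation L X) → Equation L X → ℕ → Set _
  Entails Γ e n = ∀ C → C ∈ᵥ V → ∀ ρ →
    (∀ k → k ≤ n → Satisfies C ρ (Γ k)) → Satisfies C ρ e

  Entails-upClosed : ∀ {Γ} {e : Equation L X} → UpClosed (Entails Γ e)
  Entails-upClosed i≤j entails C C∈V ρ sat =
    entails C C∈V ρ (λ k k≤i → sat k (≤-trans k≤i i≤j))

  -- Each rule needs only the maximum of the bounds of its premises; arities are finite, so this
  -- covers `compatible` too.
  compactness : ∀ {Γ : ℕ → Equation L X} {s t} →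
    CgRel (Free V X) (λ s t → ∃[ k ] (s , t) ≡ Γ k) s t →
    ∃[ n ] Entails Γ (s , t) n
  compactness (gen (k , refl)) = k , λ C C∈V ρ sat → sat k ≤-refl
  compactness (reflexive eq)   = 0 , λ C C∈V ρ sat → soundness V {A = C} C∈V ρ eq
  compactness (sym eq) with n , e ← compactness eq =
    n , λ C C∈V ρ sat → Algebra.sym C (e C C∈V ρ sat)
  compactness {Γ = Γ} (trans {a} {b} {c} eq eq′)
    with n , e ← compactness eq | n′ , e′ ← compactness eq′ =
    n ⊔ n′ , λ C C∈V ρ sat → Algebra.trans C
      (Entails-upClosed {Γ = Γ} {a , b} (m≤m⊔n n n′) e C C∈V ρ sat)
      (Entails-upClosed {Γ = Γ} {b , c} (m≤n⊔m n n′) e′ C C∈V ρ sat)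
  compactness {Γ = Γ} (compatible f {as} {bs} eq)
    with n , e ← uniform-Fin
           (λ {i} → Entails-upClosed {Γ = Γ} {as i , bs i})
           (λ i → compactness (eq i)) =
    n , λ C C∈V ρ sat → Algebra.⟦⟧-cong C f (λ i → e i C C∈V ρ sat)

  -- The generators g of S and those of the given presentation are expressed by
  -- terms v and u in each other.  The basis translates the given relations
  -- along u and adds the equations g ≈ v(u(g)).
  finite-basis : ∀ {S k} → FinitelyPresented V S →
    let module S = Algebra S in
    (g : Fin k → S.Carrier) → (∀ s → ∃[ u ] S.eval g u S.≈ s) →
    ∃[ es ] All (Satisfies S g) es ×
      (∀ C → C ∈ᵥ V → ∀ ρ → All (Satisfies C ρ) es →
       ∀ e → Satisfies S g e → Satisfies C ρ e)
  finite-basis {S} {k} (n , ps , iso) g generates =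
    List.map translate ps ++ List.tabulate back ,
    ++⁺ (map⁺ relations) (tabulate⁺ backs) ,
    complete
    where
    module S = Algebra S
    open _≅_ iso using (embedding; surjective)
      renaming (map to φ; hom to φ-hom; injective to φ-injective)
    P = Presented (Fin n) (λ s t → (s , t) ∈ ps)
    module P = Algebra P

    x : Fin n → S.Carrier
    x i = proj₁ (surjective (var i))

    φx : ∀ i → φ (x i) P.≈ var i
    φx i = proj₂ (surjective (var i)) S.refl

    u : Fin n → Term L (Fin k)
    u i = proj₁ (generates (x i))

    -- Elements of `P` are terms, so the image of a generator under `φ` is itself the term sought.
    v : Fin k → Term L (Fin n)
    v j = φ (g j)

    translate : Equation L (Fin n) → Equation L (Fin k)
    translate (p , q) = p [ u ] , q [ u ]

    back : Fin k → Equation L (Fin k)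
    back j = v j [ u ] , var j

    φ-eval-x : ∀ p → φ (S.eval x p) P.≈ p
    φ-eval-x p = P.trans (map-eval φ-hom x p)
                   (P.trans (eval-cong P φx p) (eval-var p))

    S∈V : S ∈ᵥ V
    S∈V {s} {t} e ρ = reflects embedding ρ (s , t) (Presented∈V {s = s} {t} e (φ ∘ ρ))

    eval-u : ∀ p → S.eval g (p [ u ]) S.≈ S.eval x p
    eval-u p = S.trans (eval-[] V {A = S} S∈V g u p)
                 (eval-cong S (λ i → proj₂ (generates (x i))) p)

    relations : All (Satisfies S g ∘ translate) ps
    relations = All.tabulate λ {(p , q)} pq∈ps →
      S.trans (eval-u p) (S.trans
        (φ-injective (P.trans (φ-eval-x p) (P.trans (gen pq∈ps) (P.sym (φ-eval-x q)))))
        (S.sym (eval-u q)))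

    backs : ∀ j → Satisfies S g (back j)
    backs j = S.trans (eval-u (v j)) (φ-injective (φ-eval-x (v j)))

    complete : ∀ C → C ∈ᵥ V → ∀ ρ →
      All (Satisfies C ρ) (List.map translate ps ++ List.tabulate back) →
      ∀ e → Satisfies S g e → Satisfies C ρ e
    -- The equation travels along `φ` to `P` and along `ψ` to `C`, where the image of `v` agrees
    -- with `ρ` by the equations `back`.
    complete C C∈V ρ sat e eq = Satisfies-cong C ψv e
        (preserves ψ v e (preserves φ-hom g e eq))
      where
      module C = Algebra C
      sat₁ = map⁻ (proj₁ (++⁻ (List.map translate ps) sat))
      sat₂ = tabulate⁻ (proj₂ (++⁻ (List.map translate ps) sat))

      σ : Fin n → C.Carrier
      σ i = C.eval ρ (u i)

      -- The translated relations say exactly that `σ` satisfies `ps`.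
      ψ : Hom P C
      ψ = Presented-hom C C∈V σ λ {s} {t} st∈ps →
        C.trans (C.sym (eval-[] V {A = C} C∈V ρ u s))
          (C.trans (All.lookup sat₁ st∈ps) (eval-[] V {A = C} C∈V ρ u t))

      ψv : ∀ j → C.eval σ (v j) C.≈ ρ j
      ψv j = C.trans (C.sym (eval-[] V {A = C} C∈V ρ u (v j))) (sat₂ j)

-- The order and the iterates of `t`

module Reduct {L : Signature ℓ} (V : Variety L)
  (m : Term L (Fin 2)) (semilattice : IsMeetSemilatticeTerm V m)
  (t : Term L (Fin 1)) (decreasing : Decreasing V m t) (monotone : Monotone V m t)
  where

  _≼_ : Term L X → Term L X → Equation L X
  a ≼ b = m [ (λ { zero → a ; (suc _) → b }) ] , a

  t^_·_ : ℕ → Term L X → Term L X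
  t^ k · a = iterate t k [ (λ _ → a) ]

  module In (A : Algebra L) (A∈V : A ∈ᵥ V) where
    private module A = Algebra A
    open Order m A using () renaming (_≤_ to infix 4 _⊑_)
    private
      module ∧ = IsMeetSemilattice A._≈_ (semilattice A A∈V)
      -- The library order reads x ≈ x ∧ y, the reverse orientation; hence the uses of `sym` below.
      module ⊑ = NaturalOrder A._≈_ (A.eval₂ m)

    t^ : ℕ → A.Carrier → A.Carrier
    t^ k = A.eval₁ (iterate t k)

    ⊑-refl : ∀ {a} → a ⊑ a
    ⊑-refl = ∧.idem _

    ⊑-trans : ∀ {a b c} → a ⊑ b → b ⊑ c → a ⊑ c
    ⊑-trans a⊑b b⊑c = A.sym (⊑.trans ∧.isSemigroup (A.sym a⊑b) (A.sym b⊑c))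

    ⊑-antisym : ∀ {a b} → a ⊑ b → b ⊑ a → a A.≈ b
    ⊑-antisym a⊑b b⊑a = ⊑.antisym A.isEquivalence ∧.comm (A.sym a⊑b) (A.sym b⊑a)

    ⊑-resp : ∀ {a a′ b b′} → a A.≈ a′ → b A.≈ b′ → a ⊑ b → a′ ⊑ b′
    ⊑-resp a≈a′ b≈b′ a⊑b = A.trans (∧.∧-cong (A.sym a≈a′) (A.sym b≈b′)) (A.trans a⊑b a≈a′)

    module _ (ρ : X → A.Carrier) (a b : Term L X) where
      private
        eval-∧ : A.eval ρ (proj₁ (a ≼ b)) A.≈ A.eval₂ m (A.eval ρ a) (A.eval ρ b)
        eval-∧ = A.trans (eval-[] V {A = A} A∈V ρ _ m)
          (eval-cong A (λ { zero → A.refl ; (suc zero) → A.refl }) m)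

      ≼⇒⊑ : Satisfies A ρ (a ≼ b) → A.eval ρ a ⊑ A.eval ρ b
      ≼⇒⊑ = A.trans (A.sym eval-∧)

      ⊑⇒≼ : A.eval ρ a ⊑ A.eval ρ b → Satisfies A ρ (a ≼ b)
      ⊑⇒≼ = A.trans eval-∧

    eval-t^ : (ρ : X → A.Carrier) → ∀ k a → A.eval ρ (t^ k · a) A.≈ t^ k (A.eval ρ a)
    eval-t^ ρ k a = A.trans (eval-[] V {A = A} A∈V ρ _ (iterate t k))
      (eval-cong A (λ { zero → A.refl }) (iterate t k))

    t^-suc : ∀ k a → t^ (suc k) a A.≈ A.eval₁ t (t^ k a)
    t^-suc k a = A.trans (eval-[] V {A = A} A∈V _ _ t) (eval-cong A (λ { zero → A.refl }) t)

    t^-antitone : ∀ {i j} → i ≤′ j → ∀ a → t^ j a ⊑ t^ i a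
    t^-antitone ≤′-refl           a = ⊑-refl
    t^-antitone (≤′-step {n} i≤n) a =
      ⊑-trans (⊑-resp (A.sym (t^-suc n a)) A.refl (decreasing A A∈V _)) (t^-antitone i≤n a)

    -- Applying the monotone `t` to both sides raises the exponent on the right and leaves the
    -- fixpoint on the left unchanged.
    fixpoint-⊑-t^ : ∀ {x y} → x A.≈ A.eval₁ t x → x ⊑ y → ∀ k → x ⊑ t^ k y
    fixpoint-⊑-t^ x≈tx x⊑y zero    = x⊑y
    fixpoint-⊑-t^ x≈tx x⊑y (suc k) = ⊑-resp (A.sym x≈tx) (A.sym (t^-suc k _))
      (monotone A A∈V _ _ (fixpoint-⊑-t^ x≈tx x⊑y k))

  -- The variables y, z of D are zero, suc zero.
  Γ : ℕ → Equation L (Fin 2)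
  Γ k = var (suc zero) ≼ (t^ k · var zero)

  entails⇒potent : ∀ n → Entails V Γ (Γ (suc n)) n → Potent V t n
  entails⇒potent n entails C C∈V ρ =
    Satisfies-cong C (λ { zero → C.refl }) (iterate t (suc n) , iterate t n)
      (⊑-antisym (t^-antitone {n} (≤′-step ≤′-refl) a) tⁿ⊑tⁿ⁺¹)
    where
    module C = Algebra C
    open In C C∈V
    open Order m C using () renaming (_≤_ to infix 4 _⊑_)

    a : C.Carrier
    a = ρ zero

    -- The value of z is the largest that satisfies `Γ k` for all `k ≤ n`.
    σ : Fin 2 → C.Carrier
    σ = a Vector.∷ t^ n a Vector.∷ Vector.[]

    C⊨Γ : ∀ k → k ≤ n → Satisfies C σ (Γ k)
    C⊨Γ k k≤n = ⊑⇒≼ σ (var (suc zero)) (t^ k · var zero)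
      (⊑-resp C.refl (C.sym (eval-t^ σ k (var zero))) (t^-antitone (≤⇒≤′ k≤n) a))

    tⁿ⊑tⁿ⁺¹ : t^ n a ⊑ t^ (suc n) a
    tⁿ⊑tⁿ⁺¹ = ⊑-resp C.refl (eval-t^ σ (suc n) (var zero))
      (≼⇒⊑ σ (var (suc zero)) (t^ suc n · var zero) (entails C C∈V σ C⊨Γ))

  -- Elimination of the variable x

  module Elimination (coherent : Coherent V) (fixpoint : FixpointEmbedding V m t) where

    pattern x = zero
    pattern y = suc zero
    pattern z = suc (suc zero)

    -- The variable x stands for the meet of all tᵏ(y), so that three equations can replace the
    -- infinitely many `Γ k`.
    Σ-relations : List (Equation L (Fin 3))
    Σ-relations = (var z ≼ var x) ∷ (var x ≼ var y) ∷ (var x , t^ 1 · var x) ∷ []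

    A : Algebra L
    A = Presented V (Fin 3) (λ s t → (s , t) ∈ Σ-relations)

    A∈V : A ∈ᵥ V
    A∈V {s} {t} = Presented∈V V {s = s} {t}

    -- In this order `lookup gs` sends the two variables of `Γ` to y and z.
    gs : List (Carrier A)
    gs = var y ∷ var z ∷ []

    S : Algebra L
    S = generatedSubalgebra A (_∈ gs)

    D : Algebra L
    D = Presented V (Fin 2) (λ s t → ∃[ k ] (s , t) ≡ Γ k)

    D∈V : D ∈ᵥ V
    D∈V {s} {t} = Presented∈V V {s = s} {t}

    S⊨Γ : ∀ k → Satisfies S (generators A gs) (Γ k)
    S⊨Γ k = reflects (inclusion A (_∈ gs)) (generators A gs) (Γ k)
      (⊑⇒≼ (lookup gs) (var (suc zero)) (t^ k · var zero)
        (⊑-resp A.refl (A.sym (eval-t^ (lookup gs) k (var zero)))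
          (⊑-trans z⊑x (fixpoint-⊑-t^ x≈tx x⊑y k))))
      where
      module A = Algebra A
      open In A A∈V
      open Order m A using () renaming (_≤_ to infix 4 _⊑_)

      holds : ∀ e → e ∈ Σ-relations → Satisfies A var e
      holds (s , t) e∈ = A.trans (eval-var V s) (A.trans (gen e∈) (A.sym (eval-var V t)))

      z⊑x : var z ⊑ var x
      z⊑x = ≼⇒⊑ var (var z) (var x) (holds _ (here refl))

      x⊑y : var x ⊑ var y
      x⊑y = ≼⇒⊑ var (var x) (var y) (holds _ (there (here refl)))

      x≈tx : var x A.≈ A.eval₁ t (var x)
      x≈tx = A.trans (holds _ (there (there (here refl))))
        (A.trans (eval-t^ var 1 (var x)) (t^-suc 0 (var x)))

    -- The equation holds in `A`, is carried into `B` by the homomorphism sending x to the meet `b`,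
    -- and is pulled back to `D` along `ι`.
    Γ-complete : ∀ {s t} → Satisfies S (generators A gs) (s , t) →
                 CgRel (Free V (Fin 2)) (λ s t → ∃[ k ] (s , t) ≡ Γ k) s t
    Γ-complete {s} {s′} eq
      -- The embedding condition asks only for finite generation, so it applies to `D` despite its
      -- infinitely many relations.
      with fixpoint D D∈V (Presented-finitelyGenerated V) (var zero)
    ... | B , B∈V , ι , b , (lower , greatest) , b≈tb =
      D.trans (D.sym (eval-var V s))
        (D.trans (reflects ι var (s , s′) eqB) (eval-var V s′))
      where
      module D = Algebra D
      module B = Algebra B
      open In B B∈V
      module ι = Embedding ι

      ιy ιz : B.Carrier
      ιy = ι.map (var zero)
      ιz = ι.map (var (suc zero))

      ρ : Fin 3 → B.Carrier
      ρ = b Vector.∷ ιy Vector.∷ ιz Vector.∷ Vector.[]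

      B⊨Γ : ∀ k → Satisfies B (ι.map ∘ var) (Γ k)
      B⊨Γ k = preserves ι.hom var (Γ k)
        (D.trans (eval-var V _) (D.trans (gen (k , refl))
          (D.sym (eval-var V (var (suc zero))))))

      z⊑b : Order._≤_ m B ιz b
      z⊑b = greatest ιz λ k →
        ⊑-resp B.refl (eval-t^ (ι.map ∘ var) k (var zero))
          (≼⇒⊑ (ι.map ∘ var) (var (suc zero)) (t^ k · var zero) (B⊨Γ k))

      B⊨Σ : ∀ {s t} → (s , t) ∈ Σ-relations → Satisfies B ρ (s , t)
      B⊨Σ (here refl)                 = ⊑⇒≼ ρ (var z) (var x) z⊑b
      -- The zeroth iterate is y itself.
      B⊨Σ (there (here refl))         = ⊑⇒≼ ρ (var x) (var y) (lower 0)
      B⊨Σ (there (there (here refl))) =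
        B.sym (B.trans (eval-t^ ρ 1 (var x)) (B.trans (t^-suc 0 b) (B.sym b≈tb)))

      eqB : Satisfies B (ι.map ∘ var) (s , s′)
      eqB = Satisfies-cong B (λ { zero → B.refl ; (suc zero) → B.refl }) (s , s′)
        (preserves (Presented-hom V B B∈V ρ B⊨Σ) (lookup gs) (s , s′)
          (preserves (Embedding.hom (inclusion A (_∈ gs))) (generators A gs) (s , s′) eq))

    -- Each equation in a finite basis for `S` is a consequence of some initial segment of `Γ`, and
    -- one segment serves them all. Since `S` satisfies every `Γ k`, the basis yields every `Γ k` in
    -- turn.
    Γ-finite : ∃[ n ] ∀ k → Entails V Γ (Γ k) n
    Γ-finite with es , S⊨es , complete ←
        finite-basis V
          (coherent A A∈V (3 , Σ-relations , id-≅ A) gs)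
          (generators A gs) (generators-generate A gs)
      with n , entails ← uniform (λ {e} → Entails-upClosed V {Γ = Γ} {e})
          (All.map (λ { {s , t} eq → compactness V (Γ-complete {s} {t} eq) }) S⊨es) =
      n , λ k C C∈V ρ sat →
        complete C C∈V ρ (All.map (λ e → e C C∈V ρ sat) entails) (Γ k) (S⊨Γ k)

theorem3p1 : ∀ {ℓ} (L : Signature ℓ) → HasConstant L →
    (V : Variety L) → Coherent V →
    (m : Term L (Fin 2)) → IsMeetSemilatticeTerm V m →
    (t : Term L (Fin 1)) → Decreasing V m t → Monotone V m t →
    FixpointEmbedding V m t →
    ∃[ n ] Potent V t n
theorem3p1 L _ V coherent m semilattice t decreasing monotone fixpoint =
  let open Reduct V m semilattice t decreasing monotone
      n , entails = Elimination.Γ-finite coherent fixpoint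
  -- `Γ (suc n)` is the first inequality not among the hypotheses.
  in n , entails⇒potent n (entails (suc n))
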